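{- For all sufficiently large positive integers $n$, and for every integer $\ell$ with $1 \leq \ell \leq n-1$, there exist a positive integer $d$ and an $n \times d$ integer matrix $A$ such that $A$ is a sensing matrix for $\ell$-sparse vectors, $|A| = 2$, and $$d \geq \left( \frac{n+2}{2} \right)^{1 + \frac{2}{3\ell-2}}.$$
   Context: An $n \times d$ real matrix $A$ is a sensing matrix for $\ell$-sparse vectors (signals), $1 \leq \ell \leq n$, if for every nonzero vector $\boldsymbol{x} \in \mathbb{R}^d$ with no more than $\ell$ nonzero coordinates, $A\boldsymbol{x} \neq \boldsymbol{0}$. For an integer matrix $A = (a_{ij})$, $|A| := \max_{i,j} |a_{ij}|$. -}

module Defs where

open import Data.Fin using (Fin)
open import Data.Fin.Subset using (Subset; _∈_; ∣_∣)
open import Data.Integer as ℤ using (ℤ; +_; -[1+_])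
import Data.Integer.Properties as ℤ
open import Data.Nat as ℕ using (ℕ; zero; suc; NonZero; _⊔_)
import Data.Nat.DivMod as ℕ
import Data.Nat.Properties as ℕ
import Data.Nat.Tactic.RingSolver as ℕ
open import Data.Product using (∃-syntax; _×_; _,_)
open import Data.Rational as ℚ using (ℚ; 0ℚ; 1ℚ; mkℚ; _/_)
import Data.Rational.Properties as ℚ
open import Data.Rational.Unnormalised as ℚᵘ using (ℚᵘ; mkℚᵘ; 1ℚᵘ)
import Data.Rational.Unnormalised.Properties as ℚᵘ
open import Data.Sum using (inj₁; inj₂)
open import Data.Vec.Functional using (Vector; foldr)
open import Relation.Binary.PropositionalEquality
  using (_≡_; refl; sym; trans; cong; cong₂; subst; subst₂)
open import Relation.Nullary using (¬_; yes; no)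
open import Relation.Nullary.Decidable using (dec⇒maybe)
open import Tactic.RingSolver using (solve-∀)
open import Tactic.RingSolver.Core.AlmostCommutativeRing
  using (AlmostCommutativeRing; fromCommutativeRing)

------------------------------------------------------------------------
-- Real numbers, as Cauchy sequences of rationals.  Sequences with null
-- difference are identified by _≃_.

Cauchy : (ℕ → ℚ) → Set
Cauchy x = ∀ ε → 0ℚ ℚ.< ε →
  ∃[ N ] (∀ m n → N ℕ.≤ m → N ℕ.≤ n → ℚ.∣ x m ℚ.- x n ∣ ℚ.≤ ε)

record ℝ : Set where
  constructor mkℝ
  field
    seq    : ℕ → ℚ
    cauchy : Cauchy seq

open ℝ public

infix 4 _≃_ _≤ᴿ_

_≃_ : ℝ → ℝ → Set
x ≃ y = ∀ ε → 0ℚ ℚ.< ε → ∃[ N ] (∀ n → N ℕ.≤ n → ℚ.∣ seq x n ℚ.- seq y n ∣ ℚ.≤ ε)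

_≤ᴿ_ : ℝ → ℝ → Set
x ≤ᴿ y = ∀ ε → 0ℚ ℚ.< ε → ∃[ N ] (∀ n → N ℕ.≤ n → seq x n ℚ.≤ seq y n ℚ.+ ε)

private

  ℚ-ring : AlmostCommutativeRing _ _
  ℚ-ring = fromCommutativeRing ℚ.+-*-commutativeRing (λ x → dec⇒maybe (0ℚ ℚ.≟ x))

  ½-pos : ∀ {ε} → 0ℚ ℚ.< ε → 0ℚ ℚ.< ε ℚ.* ℚ.½
  ½-pos {ε} 0<ε = ℚ.positive⁻¹ _ {{ℚ.pos*pos⇒pos ε {{ℚ.positive 0<ε}} ℚ.½}}

  halves : ∀ ε → ε ℚ.* ℚ.½ ℚ.+ ε ℚ.* ℚ.½ ≡ ε
  halves ε = trans (sym (ℚ.*-distribˡ-+ ε ℚ.½ ℚ.½)) (ℚ.*-identityʳ ε)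

fromℚ : ℚ → ℝ
fromℚ q = mkℝ (λ _ → q) λ ε 0<ε → 0 , λ _ _ _ _ →
  subst (ℚ._≤ ε) (cong ℚ.∣_∣ (sym (ℚ.+-inverseʳ q))) (ℚ.<⇒≤ 0<ε)

fromℤ : ℤ → ℝ
fromℤ k = fromℚ (k / 1)

fromℕ : ℕ → ℝ
fromℕ k = fromℤ (+ k)

0ℝ : ℝ
0ℝ = fromℚ 0ℚ

infixl 6 _+ᴿ_
infixl 7 _*ᴿ_

_+ᴿ_ : ℝ → ℝ → ℝ
x +ᴿ y = mkℝ (λ n → seq x n ℚ.+ seq y n) λ ε 0<ε →
  let (M , f) = cauchy x (ε ℚ.* ℚ.½) (½-pos 0<ε)
      (N , g) = cauchy y (ε ℚ.* ℚ.½) (½-pos 0<ε)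
  in M ℕ.⊔ N , λ m n m≥ n≥ → ℚ.≤-trans
       (ℚ.≤-reflexive (cong ℚ.∣_∣ (rearrange (seq x m) (seq y m) (seq x n) (seq y n))))
       (ℚ.≤-trans (ℚ.∣p+q∣≤∣p∣+∣q∣ (seq x m ℚ.- seq x n) (seq y m ℚ.- seq y n))
         (subst (_ ℚ.≤_) (halves ε) (ℚ.+-mono-≤
           (f m n (ℕ.m⊔n≤o⇒m≤o M N m≥) (ℕ.m⊔n≤o⇒m≤o M N n≥))
           (g m n (ℕ.m⊔n≤o⇒n≤o M N m≥) (ℕ.m⊔n≤o⇒n≤o M N n≥)))))
  where
  rearrange : ∀ a b c d → (a ℚ.+ b) ℚ.- (c ℚ.+ d) ≡ (a ℚ.- c) ℚ.+ (b ℚ.- d)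
  rearrange = solve-∀ ℚ-ring

private

  0<1ℚ : 0ℚ ℚ.< 1ℚ
  0<1ℚ = ℚ.positive⁻¹ 1ℚ

  eventually-bounded : ∀ x → ∃[ B ] ∃[ N ]
    (ℚ.Positive B × (∀ n → N ℕ.≤ n → ℚ.∣ seq x n ∣ ℚ.≤ B))
  eventually-bounded x with cauchy x 1ℚ 0<1ℚ
  ... | N , f = 1ℚ ℚ.+ ℚ.∣ seq x N ∣ , N ,
    ℚ.pos+nonNeg⇒pos 1ℚ ℚ.∣ seq x N ∣ {{ℚ.∣-∣-nonNeg (seq x N)}} ,
    λ n n≥N → ℚ.≤-trans
      (ℚ.≤-reflexive (cong ℚ.∣_∣ (split (seq x n) (seq x N))))
      (ℚ.≤-trans (ℚ.∣p+q∣≤∣p∣+∣q∣ (seq x n ℚ.- seq x N) (seq x N))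
        (ℚ.+-monoˡ-≤ ℚ.∣ seq x N ∣ (f n N n≥N ℕ.≤-refl)))
    where
    split : ∀ a b → a ≡ (a ℚ.- b) ℚ.+ b
    split = solve-∀ ℚ-ring

  ∣*∣-mono : ∀ {a b B δ} → ℚ.Positive B → ℚ.∣ a ∣ ℚ.≤ B → ℚ.∣ b ∣ ℚ.≤ δ →
             ℚ.∣ a ℚ.* b ∣ ℚ.≤ B ℚ.* δ
  ∣*∣-mono {a} {b} {B} {δ} B>0 a≤B b≤δ = ℚ.≤-trans
    (ℚ.≤-reflexive (ℚ.∣p*q∣≡∣p∣*∣q∣ a b))
    (ℚ.≤-trans
      (ℚ.*-monoʳ-≤-nonNeg ℚ.∣ b ∣ {{ℚ.∣-∣-nonNeg b}} a≤B)
      (ℚ.*-monoˡ-≤-nonNeg B {{ℚ.pos⇒nonNeg B {{B>0}}}} b≤δ))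

  split-ε : ∀ B C ε → ℚ.Positive B → ℚ.Positive C → 0ℚ ℚ.< ε →
            ∃[ δ ] (0ℚ ℚ.< δ × B ℚ.* δ ℚ.+ C ℚ.* δ ≡ ε)
  split-ε B C ε B>0 C>0 0<ε = ε ℚ.* i ,
    ℚ.positive⁻¹ (ε ℚ.* i) {{ℚ.pos*pos⇒pos ε {{ℚ.positive 0<ε}} i {{ℚ.1/pos⇒pos (B ℚ.+ C)}}}} ,
    trans (factor B C ε i)
      (trans (cong (ε ℚ.*_) (ℚ.*-inverseʳ (B ℚ.+ C))) (ℚ.*-identityʳ ε))
    where
    instance
      B+C>0 : ℚ.Positive (B ℚ.+ C)
      B+C>0 = ℚ.pos+pos⇒pos B {{B>0}} C {{C>0}}
      B+C≢0 : ℚ.NonZero (B ℚ.+ C)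
      B+C≢0 = ℚ.pos⇒nonZero (B ℚ.+ C)
    i : ℚ
    i = ℚ.1/ (B ℚ.+ C)
    factor : ∀ B C ε i → B ℚ.* (ε ℚ.* i) ℚ.+ C ℚ.* (ε ℚ.* i) ≡ ε ℚ.* ((B ℚ.+ C) ℚ.* i)
    factor = solve-∀ ℚ-ring

  product-close : ∀ {B C δ a b c d} → ℚ.Positive B → ℚ.Positive C →
    ℚ.∣ a ∣ ℚ.≤ B → ℚ.∣ d ∣ ℚ.≤ C → ℚ.∣ a ℚ.- c ∣ ℚ.≤ δ → ℚ.∣ b ℚ.- d ∣ ℚ.≤ δ →
    ℚ.∣ a ℚ.* b ℚ.- c ℚ.* d ∣ ℚ.≤ B ℚ.* δ ℚ.+ C ℚ.* δ
  product-close {a = a} {b} {c} {d} B>0 C>0 a≤B d≤C ac bd = ℚ.≤-trans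
    (ℚ.≤-reflexive (cong ℚ.∣_∣ (rearrange a b c d)))
    (ℚ.≤-trans (ℚ.∣p+q∣≤∣p∣+∣q∣ (a ℚ.* (b ℚ.- d)) (d ℚ.* (a ℚ.- c)))
      (ℚ.+-mono-≤ (∣*∣-mono {a} {b ℚ.- d} B>0 a≤B bd) (∣*∣-mono {d} {a ℚ.- c} C>0 d≤C ac)))
    where
    rearrange : ∀ a b c d → a ℚ.* b ℚ.- c ℚ.* d ≡ a ℚ.* (b ℚ.- d) ℚ.+ d ℚ.* (a ℚ.- c)
    rearrange = solve-∀ ℚ-ring

_*ᴿ_ : ℝ → ℝ → ℝ
x *ᴿ y = mkℝ (λ n → seq x n ℚ.* seq y n) λ ε 0<ε →
  let (B , K , B>0 , f)  = eventually-bounded x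
      (C , L , C>0 , g)  = eventually-bounded y
      (δ , 0<δ , δ-sum)  = split-ε B C ε B>0 C>0 0<ε
      (M , h)            = cauchy x δ 0<δ
      (N , k)            = cauchy y δ 0<δ
  in (K ℕ.⊔ M) ℕ.⊔ (L ℕ.⊔ N) , λ m n m≥ n≥ →
    let KM≤m = ℕ.m⊔n≤o⇒m≤o (K ℕ.⊔ M) (L ℕ.⊔ N) m≥
        KM≤n = ℕ.m⊔n≤o⇒m≤o (K ℕ.⊔ M) (L ℕ.⊔ N) n≥
        LN≤m = ℕ.m⊔n≤o⇒n≤o (K ℕ.⊔ M) (L ℕ.⊔ N) m≥
        LN≤n = ℕ.m⊔n≤o⇒n≤o (K ℕ.⊔ M) (L ℕ.⊔ N) n≥
    in subst (ℚ.∣ seq x m ℚ.* seq y m ℚ.- seq x n ℚ.* seq y n ∣ ℚ.≤_) δ-sum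
         (product-close {a = seq x m} {seq y m} {seq x n} {seq y n} B>0 C>0
           (f m (ℕ.m⊔n≤o⇒m≤o K M KM≤m)) (g n (ℕ.m⊔n≤o⇒m≤o L N LN≤n))
           (h m n (ℕ.m⊔n≤o⇒n≤o K M KM≤m) (ℕ.m⊔n≤o⇒n≤o K M KM≤n))
           (k m n (ℕ.m⊔n≤o⇒n≤o L N LN≤m) (ℕ.m⊔n≤o⇒n≤o L N LN≤n)))

------------------------------------------------------------------------
-- Rational powers of nonnegative rationals

-- iroot q m = ⌊ m^(1/q) ⌋ for q ≥ 1, see iroot-lower and iroot-upper.
-- The search starts at m, which is large enough as k ≤ k^q.

private
  search : ℕ → ℕ → ℕ → ℕ
  search q m zero    = zero
  search q m (suc k) with suc k ℕ.^ q ℕ.≤? m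
  ... | yes _ = suc k
  ... | no  _ = search q m k

iroot : ℕ → ℕ → ℕ
iroot q m = search q m m

iroot-lower : ∀ q .{{_ : NonZero q}} m → iroot q m ℕ.^ q ℕ.≤ m
iroot-lower q m = go q m
  where
  go : ∀ q .{{_ : NonZero q}} k → search q m k ℕ.^ q ℕ.≤ m
  go (suc q) zero = ℕ.z≤n
  go q (suc k) with suc k ℕ.^ q ℕ.≤? m
  ... | yes p = p
  ... | no  _ = go q k

iroot-upper : ∀ q .{{_ : NonZero q}} m → m ℕ.< suc (iroot q m) ℕ.^ q
iroot-upper q m = go m (k≤k^q q)
  where
  k≤k^q : ∀ q .{{_ : NonZero q}} → m ℕ.< suc m ℕ.^ q
  k≤k^q (suc q) = ℕ.m≤m*n (suc m) (suc m ℕ.^ q) {{ℕ.m^n≢0 (suc m) q}}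
  go : ∀ k → m ℕ.< suc k ℕ.^ q → m ℕ.< suc (search q m k) ℕ.^ q
  go zero    h = h
  go (suc k) h with suc k ℕ.^ q ℕ.≤? m
  ... | yes _ = h
  ... | no ¬p = go k (ℕ.≰⇒> ¬p)

-- (a/b)^(p/q) is the limit of ⌊ N · (a/b)^(p/q) ⌋ / N, where N = n + 1.
-- powNum n is this floor: by powNum-lower and powNum-upper it is the k with
-- k^q ≤ N^q · (a/b)^p < (k + 1)^q.

module _ (a b p q : ℕ) .{{_ : NonZero b}} .{{_ : NonZero q}} where

  private instance
    b^p≢0 : NonZero (b ℕ.^ p)
    b^p≢0 = ℕ.m^n≢0 b p

  powNum : ℕ → ℕ
  powNum n = iroot q ((a ℕ.^ p ℕ.* suc n ℕ.^ q) ℕ./ (b ℕ.^ p))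

  powSeq : ℕ → ℚ
  powSeq n = + powNum n / suc n

  powNum-lower : ∀ n → powNum n ℕ.^ q ℕ.* b ℕ.^ p ℕ.≤ a ℕ.^ p ℕ.* suc n ℕ.^ q
  powNum-lower n = ℕ.≤-trans (ℕ.*-monoˡ-≤ B (iroot-lower q (M ℕ./ B))) (ℕ.m/n*n≤m M B)
    where
    M = a ℕ.^ p ℕ.* suc n ℕ.^ q
    B = b ℕ.^ p

  powNum-upper : ∀ n → a ℕ.^ p ℕ.* suc n ℕ.^ q ℕ.< suc (powNum n) ℕ.^ q ℕ.* b ℕ.^ p
  powNum-upper n = ℕ.≰⇒> λ h → ℕ.<⇒≱ (iroot-upper q (M ℕ./ B))
    (subst (ℕ._≤ M ℕ./ B) (ℕ.m*n/n≡m (suc (powNum n) ℕ.^ q) B) (ℕ./-monoˡ-≤ B h))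
    where
    M = a ℕ.^ p ℕ.* suc n ℕ.^ q
    B = b ℕ.^ p

  private
    ^-cancel-< : ∀ {j k} → j ℕ.^ q ℕ.< k ℕ.^ q → j ℕ.< k
    ^-cancel-< h = ℕ.≰⇒> λ k≤j → ℕ.<⇒≱ h (ℕ.^-monoˡ-≤ q k≤j)

    ^-distrib-* : ∀ j k q → (j ℕ.* k) ℕ.^ q ≡ j ℕ.^ q ℕ.* k ℕ.^ q
    ^-distrib-* j k zero    = refl
    ^-distrib-* j k (suc q) =
      trans (cong (j ℕ.* k ℕ.*_) (^-distrib-* j k q)) (swap j k (j ℕ.^ q) (k ℕ.^ q))
      where
      swap : ∀ j k u v → j ℕ.* k ℕ.* (u ℕ.* v) ≡ j ℕ.* u ℕ.* (k ℕ.* v)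
      swap = ℕ.solve-∀

    cross : ∀ m n → powNum m ℕ.* suc n ℕ.≤ suc (powNum n) ℕ.* suc m
    cross m n = ℕ.<⇒≤ (^-cancel-< (ℕ.*-cancelʳ-< _ _ _ (begin-strict
      (j ℕ.* N) ℕ.^ q ℕ.* B           ≡⟨ cong (ℕ._* B) (^-distrib-* j N q) ⟩
      j ℕ.^ q ℕ.* N ℕ.^ q ℕ.* B       ≡⟨ e₁ (j ℕ.^ q) (N ℕ.^ q) B ⟩
      j ℕ.^ q ℕ.* B ℕ.* N ℕ.^ q       ≤⟨ ℕ.*-monoˡ-≤ (N ℕ.^ q) (powNum-lower m) ⟩
      A ℕ.* M ℕ.^ q ℕ.* N ℕ.^ q       ≡⟨ e₁ A (M ℕ.^ q) (N ℕ.^ q) ⟩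
      A ℕ.* N ℕ.^ q ℕ.* M ℕ.^ q       <⟨ ℕ.*-monoˡ-< (M ℕ.^ q) {{ℕ.m^n≢0 M q}} (powNum-upper n) ⟩
      k ℕ.^ q ℕ.* B ℕ.* M ℕ.^ q       ≡⟨ e₁ (k ℕ.^ q) B (M ℕ.^ q) ⟩
      k ℕ.^ q ℕ.* M ℕ.^ q ℕ.* B       ≡⟨ cong (ℕ._* B) (^-distrib-* k M q) ⟨
      (k ℕ.* M) ℕ.^ q ℕ.* B           ∎)))
      where
      open ℕ.≤-Reasoning
      A = a ℕ.^ p
      B = b ℕ.^ p
      M = suc m
      N = suc n
      j = powNum m
      k = suc (powNum n)
      e₁ : ∀ x y z → x ℕ.* y ℕ.* z ≡ x ℕ.* z ℕ.* y
      e₁ = ℕ.solve-∀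

    powSeq-close : ∀ m n → powSeq m ℚ.≤ powSeq n ℚ.+ + 1 / suc n
    powSeq-close m n = ℚ.toℚᵘ-cancel-≤ (begin
      ℚ.toℚᵘ (powSeq m)                            ≃⟨ ℚ.toℚᵘ-fromℚᵘ (mkℚᵘ (+ powNum m) m) ⟩
      mkℚᵘ (+ powNum m) m                          ≤⟨ ℚᵘ.*≤* (subst₂ ℤ._≤_
                                                        (ℤ.pos-* (powNum m) (suc n))
                                                        (ℤ.pos-* (suc (powNum n)) (suc m))
                                                        (ℤ.+≤+ (cross m n))) ⟩
      mkℚᵘ (+ suc (powNum n)) n                    ≃⟨ add ⟩
      mkℚᵘ (+ powNum n) n ℚᵘ.+ mkℚᵘ (+ 1) n        ≃⟨ ℚᵘ.+-cong (ℚ.toℚᵘ-fromℚᵘ (mkℚᵘ (+ powNum n) n)) (ℚ.toℚᵘ-fromℚᵘ (mkℚᵘ (+ 1) n)) ⟨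
      ℚ.toℚᵘ (powSeq n) ℚᵘ.+ ℚ.toℚᵘ (+ 1 / suc n)  ≃⟨ ℚ.toℚᵘ-homo-+ (powSeq n) (+ 1 / suc n) ⟨
      ℚ.toℚᵘ (powSeq n ℚ.+ + 1 / suc n)            ∎)
      where
      open ℚᵘ.≤-Reasoning
      arith : ∀ k N → suc k ℕ.* (N ℕ.* N) ≡ (k ℕ.* N ℕ.+ 1 ℕ.* N) ℕ.* N
      arith = ℕ.solve-∀
      add : mkℚᵘ (+ suc (powNum n)) n ℚᵘ.≃ mkℚᵘ (+ powNum n) n ℚᵘ.+ mkℚᵘ (+ 1) n
      add = ℚᵘ.*≡* (trans (sym (ℤ.pos-* (suc (powNum n)) (suc n ℕ.* suc n)))
        (trans (cong +_ (arith (powNum n) (suc n)))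
        (trans (ℤ.pos-* (powNum n ℕ.* suc n ℕ.+ 1 ℕ.* suc n) (suc n))
          (cong (ℤ._* + suc n) (cong₂ ℤ._+_ (ℤ.pos-* (powNum n) (suc n)) (ℤ.pos-* 1 (suc n)))))))

    archimedean : ∀ ε → 0ℚ ℚ.< ε → ∃[ N ] (∀ n → N ℕ.≤ n → + 1 / suc n ℚ.≤ ε)
    archimedean ε@(mkℚ (+ suc c) d _) _ = d , λ n d≤n → ℚ.toℚᵘ-cancel-≤
      (ℚᵘ.≤-respˡ-≃ (ℚᵘ.≃-sym (ℚ.toℚᵘ-fromℚᵘ (mkℚᵘ (+ 1) n)))
        (ℚᵘ.*≤* (subst₂ ℤ._≤_ (ℤ.pos-* 1 (suc d)) (ℤ.pos-* (suc c) (suc n))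
          (ℤ.+≤+ (ℕ.*-mono-≤ (ℕ.s≤s (ℕ.z≤n {c})) (ℕ.s≤s d≤n))))))
    archimedean (mkℚ (+ zero) _ _) (ℚ.*<* (ℤ.+<+ ()))
    archimedean (mkℚ -[1+ _ ] _ _) (ℚ.*<* ())

    ∣-∣-≤ : ∀ {x y ε} → x ℚ.≤ y ℚ.+ ε → y ℚ.≤ x ℚ.+ ε → ℚ.∣ x ℚ.- y ∣ ℚ.≤ ε
    ∣-∣-≤ {x} {y} {ε} x≤ y≤ with ℚ.∣p∣≡p∨∣p∣≡-p (x ℚ.- y)
    ... | inj₁ eq = subst₂ ℚ._≤_ (sym eq) (cancel y ε) (ℚ.+-monoˡ-≤ (ℚ.- y) x≤)
      where
      cancel : ∀ y ε → y ℚ.+ ε ℚ.- y ≡ ε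
      cancel = solve-∀ ℚ-ring
    ... | inj₂ eq = subst₂ ℚ._≤_ (trans (flip x y) (sym eq)) (cancel x ε) (ℚ.+-monoˡ-≤ (ℚ.- x) y≤)
      where
      flip : ∀ x y → y ℚ.- x ≡ ℚ.- (x ℚ.- y)
      flip = solve-∀ ℚ-ring
      cancel : ∀ y ε → y ℚ.+ ε ℚ.- y ≡ ε
      cancel = solve-∀ ℚ-ring

  powSeq-cauchy : Cauchy powSeq
  powSeq-cauchy ε 0<ε with archimedean ε 0<ε
  ... | N , f = N , λ m n m≥ n≥ → ∣-∣-≤
    (ℚ.≤-trans (powSeq-close m n) (ℚ.+-monoʳ-≤ (powSeq n) (f n n≥)))
    (ℚ.≤-trans (powSeq-close n m) (ℚ.+-monoʳ-≤ (powSeq m) (f m m≥)))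

-- Base and exponent are unnormalised fractions so that their numerators and
-- denominators compute; the real number depends only on their values.

infixr 8 _^ᴿ_

_^ᴿ_ : (r e : ℚᵘ) .{{_ : ℚᵘ.NonNegative r}} .{{_ : ℚᵘ.NonNegative e}} → ℝ
r ^ᴿ e = mkℝ (powSeq a b p q) (powSeq-cauchy a b p q)
  where
  a = ℤ.∣ ℚᵘ.↥ r ∣
  b = ℚᵘ.↧ₙ r
  p = ℤ.∣ ℚᵘ.↥ e ∣
  q = ℚᵘ.↧ₙ e

-- Used to form the exponent 1 + 2/(3ℓ - 2).

instance
  3ℓ∸2-nonZero : ∀ {ℓ} .{{_ : NonZero ℓ}} → NonZero (3 ℕ.* ℓ ℕ.∸ 2)
  3ℓ∸2-nonZero {suc ℓ} = ℕ.>-nonZero (ℕ.m<n⇒0<n∸m (ℕ.*-monoʳ-≤ 3 (ℕ.s≤s (ℕ.z≤n {ℓ}))))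

  1+2/k-nonNegative : ∀ {k} .{{_ : NonZero k}} → ℚᵘ.NonNegative (1ℚᵘ ℚᵘ.+ + 2 ℚᵘ./ k)
  1+2/k-nonNegative {suc k} = ℤ.nonNeg

------------------------------------------------------------------------
-- Sensing matrices

-- n rows, d columns.
Matrix : Set → ℕ → ℕ → Set
Matrix X n d = Fin n → Fin d → X

realMatrix : ∀ {n d} → Matrix ℤ n d → Matrix ℝ n d
realMatrix A i j = fromℤ (A i j)

_*ᵥ_ : ∀ {n d} → Matrix ℝ n d → Vector ℝ d → Vector ℝ n
(A *ᵥ x) i = foldr _+ᴿ_ 0ℝ (λ j → A i j *ᴿ x j)

IsZero : ∀ {d} → Vector ℝ d → Set
IsZero x = ∀ j → x j ≃ 0ℝ

-- Vanishing of a real is not decidable, so sparsity is expressed as a bound on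
-- every set of nonzero coordinates rather than on the size of a computed support.
IsSparse : ∀ {d} → ℕ → Vector ℝ d → Set
IsSparse {d} ℓ x = ∀ (S : Subset d) → (∀ {j} → j ∈ S → ¬ x j ≃ 0ℝ) → ∣ S ∣ ℕ.≤ ℓ

IsSensing : ∀ {n d} → ℕ → Matrix ℝ n d → Set
IsSensing {d = d} ℓ A =
  ∀ (x : Vector ℝ d) → ¬ IsZero x → IsSparse ℓ x → ¬ IsZero (A *ᵥ x)

-- max ∣ a i j ∣, with value 0 for an empty matrix.
height : ∀ {n d} → Matrix ℤ n d → ℕ
height A = foldr _⊔_ 0 (λ i → foldr _⊔_ 0 (λ j → ℤ.∣ A i j ∣))

{-# OPTIONS --safe #-}

-- If n² ≤ 2^ℓ, twice the identity matrix already has enough columns.  Otherwise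
-- ℓ = O(log n), and we use the Vandermonde columns (t^i), i < ℓ, for 0 ≤ t < 3^m
-- with 3^m ≥ n³: any ℓ of them are independent, and the exponent 1 + 2/(3ℓ − 2)
-- never exceeds 3.  Replacing each entry t^i by the column of its base 3 digits
-- only enlarges the row span, brings the entries down to {0, 1, 2}, and needs no
-- more than ℓ · ℓm = O(log³ n) rows.

module Submission where

open import Defs
open import Data.Bool using (not)
open import Data.Fin as Fin using (Fin; zero; suc; toℕ; fromℕ<)
import Data.Fin.Properties as Fin
open import Data.Fin.Subset using (Subset; inside; outside; _∈_; _-_; ∣_∣)
import Data.Fin.Subset.Properties as Subset
open import Data.Integer as ℤ using (ℤ; +_; 0ℤ)
import Data.Integer.Properties as ℤ
import Data.Integer.Tactic.RingSolver as ℤ-Solver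
open import Data.Nat as ℕ
  using (ℕ; NonZero; zero; suc; _+_; _*_; _^_; _∸_; _%_; _⊔_; _≤_; _≥_; _<_; z≤n; s≤s)
open import Data.Nat.Divisibility using (divides-refl)
open import Data.Nat.DivMod
  using (m≡m%n+[m/n]*n; m%n<n; [m+kn]%n≡m%n; m<n⇒m%n≡m; m<n⇒m/n≡0; m*n/n≡m; +-distrib-/-∣ʳ; m<n*o⇒m/o<n)
import Data.Nat.Properties as ℕ
import Data.Nat.Tactic.RingSolver as ℕ-Solver
open import Data.Product using (Σ-syntax; ∃-syntax; _×_; _,_)
open import Data.Rational as ℚ using (ℚ; 0ℚ)
import Data.Rational.Properties as ℚ
open import Data.Rational.Unnormalised as ℚᵘ using (mkℚᵘ; 1ℚᵘ; _/_)
import Data.Rational.Unnormalised.Properties as ℚᵘ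
open import Data.Sum using (_⊎_; inj₁; inj₂)
open import Data.Vec as Vec using ([]; _∷_; here; there)
import Data.Vec.Properties as Vec
open import Data.Vec.Functional using (Vector; foldr)
open import Effect.Monad using (RawMonad)
open import Function using (_∘_)
open import Relation.Binary.PropositionalEquality
  using (_≡_; _≢_; _≗_; refl; sym; trans; cong; cong₂; subst; subst₂; module ≡-Reasoning)
open import Relation.Nullary using (¬_; Dec; yes; no; does; contradiction)
open import Relation.Nullary.Decidable using (dec⇒maybe; dec-false; ¬¬-excluded-middle; from-yes)
open import Relation.Nullary.Negation using (¬¬-Monad)
open import Tactic.RingSolver using (solve-∀)
open import Tactic.RingSolver.Core.AlmostCommutativeRing
  using (AlmostCommutativeRing; fromCommutativeRing)

private variable
  n d : ℕ

ℚ-ring : AlmostCommutativeRing _ _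
ℚ-ring = fromCommutativeRing ℚ.+-*-commutativeRing (λ x → dec⇒maybe (0ℚ ℚ.≟ x))

-- Null sequences and linear forms with integer coefficients

-- A record rather than a plain definition, so that `u` can be inferred from the type `Null u`.
record Null (u : ℕ → ℚ) : Set where
  constructor null
  field small : ∀ ε → 0ℚ ℚ.< ε → ∃[ N ] (∀ n → N ≤ n → ℚ.∣ u n ∣ ℚ.≤ ε)

open Null

≃0⇒null : ∀ {x} → x ≃ 0ℝ → Null (seq x)
≃0⇒null {x} x≃0 = null λ ε 0<ε → let (N , f) = x≃0 ε 0<ε in
  N , λ n n≥N → subst (λ a → ℚ.∣ a ∣ ℚ.≤ ε) (ℚ.+-identityʳ (seq x n)) (f n n≥N)

null⇒≃0 : ∀ {x} → Null (seq x) → x ≃ 0ℝ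
null⇒≃0 {x} x≃0 ε 0<ε = let (N , f) = small x≃0 ε 0<ε in
  N , λ n n≥N → subst (λ a → ℚ.∣ a ∣ ℚ.≤ ε) (sym (ℚ.+-identityʳ (seq x n))) (f n n≥N)

null-resp : ∀ {u v} → u ≗ v → Null u → Null v
null-resp u≗v u≃0 = null λ ε 0<ε → let (N , f) = small u≃0 ε 0<ε in
  N , λ n n≥N → subst (λ a → ℚ.∣ a ∣ ℚ.≤ ε) (u≗v n) (f n n≥N)

null-0 : Null (λ _ → 0ℚ)
null-0 = null λ ε 0<ε → 0 , λ _ _ → ℚ.<⇒≤ 0<ε

null-− : ∀ {u v} → Null u → Null v → Null (λ n → u n ℚ.- v n)
null-− {u} {v} u≃0 v≃0 = null λ ε 0<ε →
  let 0<ε/2   = ℚ.positive⁻¹ _ {{ℚ.pos*pos⇒pos ε {{ℚ.positive 0<ε}} ℚ.½}}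
      (M , f) = small u≃0 (ε ℚ.* ℚ.½) 0<ε/2
      (N , g) = small v≃0 (ε ℚ.* ℚ.½) 0<ε/2
  in M ⊔ N , λ n n≥ → begin
    ℚ.∣ u n ℚ.- v n ∣            ≤⟨ ℚ.∣p-q∣≤∣p∣+∣q∣ (u n) (v n) ⟩
    ℚ.∣ u n ∣ ℚ.+ ℚ.∣ v n ∣      ≤⟨ ℚ.+-mono-≤ (f n (ℕ.m⊔n≤o⇒m≤o M N n≥)) (g n (ℕ.m⊔n≤o⇒n≤o M N n≥)) ⟩
    ε ℚ.* ℚ.½ ℚ.+ ε ℚ.* ℚ.½      ≡⟨ ℚ.*-distribˡ-+ ε ℚ.½ ℚ.½ ⟨
    ε ℚ.* (ℚ.½ ℚ.+ ℚ.½)          ≡⟨ ℚ.*-identityʳ ε ⟩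
    ε                            ∎
  where open ℚ.≤-Reasoning

null-+ : ∀ {u v} → Null u → Null v → Null (λ n → u n ℚ.+ v n)
null-+ {u} {v} u≃0 v≃0 = null-resp (λ n → eq (u n) (v n)) (null-− u≃0 (null-− null-0 v≃0))
  where
  eq : ∀ a b → a ℚ.- (0ℚ ℚ.- b) ≡ a ℚ.+ b
  eq = solve-∀ ℚ-ring

null-*ʳ : ∀ {u} c → Null u → Null (λ n → c ℚ.* u n)
null-*ʳ {u} c u≃0 = null λ ε 0<ε →
  let (N , f) = small u≃0 (i ℚ.* ε) (ℚ.positive⁻¹ _ {{ℚ.pos*pos⇒pos i {{ℚ.1/pos⇒pos C}} ε {{ℚ.positive 0<ε}}}})
  in N , λ n n≥N → begin
    ℚ.∣ c ℚ.* u n ∣          ≡⟨ ℚ.∣p*q∣≡∣p∣*∣q∣ c (u n) ⟩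
    ℚ.∣ c ∣ ℚ.* ℚ.∣ u n ∣    ≤⟨ ℚ.*-monoʳ-≤-nonNeg ℚ.∣ u n ∣ {{ℚ.∣-∣-nonNeg (u n)}} ∣c∣≤C ⟩
    C ℚ.* ℚ.∣ u n ∣          ≤⟨ ℚ.*-monoˡ-≤-nonNeg C {{ℚ.pos⇒nonNeg C}} (f n n≥N) ⟩
    C ℚ.* (i ℚ.* ε)          ≡⟨ ℚ.*-assoc C i ε ⟨
    (C ℚ.* i) ℚ.* ε          ≡⟨ cong (ℚ._* ε) (ℚ.*-inverseʳ C) ⟩
    ℚ.1ℚ ℚ.* ε               ≡⟨ ℚ.*-identityˡ ε ⟩
    ε                        ∎
  where
  open ℚ.≤-Reasoning
  -- Adding 1 to `ℚ.∣ c ∣` makes the bound invertible also for `c` equal to zero.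
  C : ℚ
  C = ℚ.1ℚ ℚ.+ ℚ.∣ c ∣
  instance
    C>0 : ℚ.Positive C
    C>0 = ℚ.pos+nonNeg⇒pos ℚ.1ℚ ℚ.∣ c ∣ {{ℚ.∣-∣-nonNeg c}}
    C≢0 : ℚ.NonZero C
    C≢0 = ℚ.pos⇒nonZero C
  i : ℚ
  i = ℚ.1/ C
  ∣c∣≤C : ℚ.∣ c ∣ ℚ.≤ C
  ∣c∣≤C = ℚ.≤-trans (ℚ.≤-reflexive (sym (ℚ.+-identityˡ ℚ.∣ c ∣)))
    (ℚ.+-monoˡ-≤ ℚ.∣ c ∣ (ℚ.<⇒≤ (ℚ.positive⁻¹ ℚ.1ℚ)))

null-*ˡ : ∀ {c} (u : ℕ → ℚ) → c ≡ 0ℤ → Null (λ n → c ℚ./ 1 ℚ.* u n)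
null-*ˡ u refl = null-resp (λ n → sym (ℚ.*-zeroˡ (u n))) null-0

fromℤ-− : ∀ a b → (a ℤ.- b) ℚ./ 1 ≡ a ℚ./ 1 ℚ.- b ℚ./ 1
fromℤ-− a b = ℚ.toℚᵘ-injective (begin-equality
  ℚ.toℚᵘ ((a ℤ.- b) ℚ./ 1)                       ≃⟨ ℚ.toℚᵘ-fromℚᵘ (mkℚᵘ (a ℤ.- b) 0) ⟩
  mkℚᵘ (a ℤ.- b) 0                               ≃⟨ ℚᵘ.*≡* (arith a b) ⟩
  mkℚᵘ a 0 ℚᵘ.- mkℚᵘ b 0                         ≃⟨ ℚᵘ.+-cong (ℚ.toℚᵘ-fromℚᵘ (mkℚᵘ a 0)) (ℚᵘ.-‿cong (ℚ.toℚᵘ-fromℚᵘ (mkℚᵘ b 0))) ⟨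
  ℚ.toℚᵘ (a ℚ./ 1) ℚᵘ.- ℚ.toℚᵘ (b ℚ./ 1)         ≃⟨ ℚᵘ.+-congʳ (ℚ.toℚᵘ (a ℚ./ 1)) (ℚ.toℚᵘ-homo‿- (b ℚ./ 1)) ⟨
  ℚ.toℚᵘ (a ℚ./ 1) ℚᵘ.+ ℚ.toℚᵘ (ℚ.- (b ℚ./ 1))   ≃⟨ ℚ.toℚᵘ-homo-+ (a ℚ./ 1) (ℚ.- (b ℚ./ 1)) ⟨
  ℚ.toℚᵘ (a ℚ./ 1 ℚ.- b ℚ./ 1)                   ∎)
  where
  open ℚᵘ.≤-Reasoning
  arith : ∀ a b → (a ℤ.- b) ℤ.* (+ 1) ≡ (a ℤ.* + 1 ℤ.+ ℤ.- b ℤ.* + 1) ℤ.* + 1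
  arith = ℤ-Solver.solve-∀

1≤∣fromℤ∣ : ∀ c → c ≢ 0ℤ → ℚ.1ℚ ℚ.≤ ℚ.∣ c ℚ./ 1 ∣
1≤∣fromℤ∣ c c≢0 = ℚ.toℚᵘ-cancel-≤ (begin
  mkℚᵘ (+ 1) 0                 ≤⟨ ℚᵘ.*≤* (ℤ.*-monoʳ-≤-nonNeg (+ 1) (ℤ.+≤+ (ℕ.n≢0⇒n>0 (c≢0 ∘ ℤ.∣i∣≡0⇒i≡0)))) ⟩
  mkℚᵘ (+ ℤ.∣ c ∣) 0           ≃⟨ ℚᵘ.∣-∣-cong (ℚ.toℚᵘ-fromℚᵘ (mkℚᵘ c 0)) ⟨
  ℚᵘ.∣ ℚ.toℚᵘ (c ℚ./ 1) ∣      ≃⟨ ℚ.toℚᵘ-homo-∣-∣ (c ℚ./ 1) ⟨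
  ℚ.toℚᵘ ℚ.∣ c ℚ./ 1 ∣         ∎)
  where open ℚᵘ.≤-Reasoning

-- A nonzero integer has absolute value at least 1, so multiplying by it never shrinks a term, and
-- the same `N` serves for `u`. This is what integer coefficients buy: no division occurs.
null-cancel : ∀ {c u} → c ≢ 0ℤ → Null (λ n → c ℚ./ 1 ℚ.* u n) → Null u
null-cancel {c} {u} c≢0 cu≃0 = null λ ε 0<ε →
  let (N , f) = small cu≃0 ε 0<ε in N , λ n n≥N → begin
    ℚ.∣ u n ∣                      ≡⟨ ℚ.*-identityˡ ℚ.∣ u n ∣ ⟨
    ℚ.1ℚ ℚ.* ℚ.∣ u n ∣             ≤⟨ ℚ.*-monoʳ-≤-nonNeg ℚ.∣ u n ∣ {{ℚ.∣-∣-nonNeg (u n)}} (1≤∣fromℤ∣ c c≢0) ⟩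
    ℚ.∣ c ℚ./ 1 ∣ ℚ.* ℚ.∣ u n ∣    ≡⟨ ℚ.∣p*q∣≡∣p∣*∣q∣ (c ℚ./ 1) (u n) ⟨
    ℚ.∣ c ℚ./ 1 ℚ.* u n ∣          ≤⟨ f n n≥N ⟩
    ε                              ∎
  where open ℚ.≤-Reasoning

∑ : (Fin d → ℕ → ℚ) → ℕ → ℚ
∑ y n = foldr ℚ._+_ 0ℚ (λ j → y j n)

∑-null : ∀ {y : Fin d → ℕ → ℚ} → (∀ j → Null (y j)) → Null (∑ y)
∑-null {zero}  y≃0 = null-0
∑-null {suc d} y≃0 = null-+ (y≃0 zero) (∑-null (y≃0 ∘ suc))

∑-isolate : ∀ {y : Fin d → ℕ → ℚ} j → (∀ i → i ≢ j → Null (y i)) → Null (∑ y) → Null (y j)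
∑-isolate {suc d} {y} zero others ∑≃0 =
  null-resp (λ n → cancel (y zero n) (∑ (y ∘ suc) n))
    (null-− ∑≃0 (∑-null (λ i → others (suc i) λ ())))
  where
  cancel : ∀ a b → (a ℚ.+ b) ℚ.- b ≡ a
  cancel = solve-∀ ℚ-ring
∑-isolate {suc d} {y} (suc j) others ∑≃0 =
  ∑-isolate j (λ i i≢j → others (suc i) (i≢j ∘ Fin.suc-injective))
    (null-resp (λ n → cancel (y zero n) (∑ (y ∘ suc) n)) (null-− ∑≃0 (others zero λ ())))
  where
  cancel : ∀ a b → (a ℚ.+ b) ℚ.- a ≡ b
  cancel = solve-∀ ℚ-ring

seq-foldr : ∀ (y : Vector ℝ d) → seq (foldr _+ᴿ_ 0ℝ y) ≗ ∑ (seq ∘ y)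
seq-foldr {zero}  y n = refl
seq-foldr {suc d} y n = cong (seq (y zero) n ℚ.+_) (seq-foldr (y ∘ suc) n)

⟨_,_⟩ : (Fin d → ℤ) → (Fin d → ℕ → ℚ) → ℕ → ℚ
⟨ f , x ⟩ = ∑ (λ j n → f j ℚ./ 1 ℚ.* x j n)

⟨⟩-− : ∀ (f g : Fin d → ℤ) x n → ⟨ (λ j → f j ℤ.- g j) , x ⟩ n ≡ ⟨ f , x ⟩ n ℚ.- ⟨ g , x ⟩ n
⟨⟩-− {zero}  f g x n = refl
⟨⟩-− {suc d} f g x n = trans
  (cong₂ (λ c s → c ℚ.* x zero n ℚ.+ s) (fromℤ-− (f zero) (g zero))
    (⟨⟩-− (f ∘ suc) (g ∘ suc) (x ∘ suc) n))
  (rearrange (f zero ℚ./ 1) (g zero ℚ./ 1) (x zero n) _ _)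
  where
  rearrange : ∀ a b c s t → (a ℚ.- b) ℚ.* c ℚ.+ (s ℚ.- t) ≡ (a ℚ.* c ℚ.+ s) ℚ.- (b ℚ.* c ℚ.+ t)
  rearrange = solve-∀ ℚ-ring

⟨⟩-congˡ : ∀ {f g : Fin d → ℤ} x → f ≗ g → ⟨ f , x ⟩ ≗ ⟨ g , x ⟩
⟨⟩-congˡ {zero}  x f≗g n = refl
⟨⟩-congˡ {suc d} x f≗g n =
  cong₂ (λ c s → c ℚ./ 1 ℚ.* x zero n ℚ.+ s) (f≗g zero) (⟨⟩-congˡ (x ∘ suc) (f≗g ∘ suc) n)

-- Integer row spans

-- Subtraction and `zero` suffice as generators: sums and natural multiples are derived from them
-- below. `resp` replaces function extensionality.
data Span {n d} (A : Matrix ℤ n d) : (Fin d → ℤ) → Set where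
  row  : ∀ i → Span A (A i)
  zero : Span A (λ _ → 0ℤ)
  sub  : ∀ {f g} → Span A f → Span A g → Span A (λ j → f j ℤ.- g j)
  resp : ∀ {f g} → f ≗ g → Span A f → Span A g

module _ {A : Matrix ℤ n d} where

  -- Pairing with `x` respects differences, so a form in the span may be used against a kernel
  -- vector just like an actual row.
  Span-null : ∀ {f} x → (∀ i → Null ⟨ A i , x ⟩) → Span A f → Null ⟨ f , x ⟩
  Span-null x Ax≃0 (row i)              = Ax≃0 i
  Span-null x Ax≃0 zero                 = ∑-null (λ j → null-*ˡ (x j) refl)
  Span-null x Ax≃0 (sub {f} {g} F G)    =
    null-resp (λ n → sym (⟨⟩-− f g x n)) (null-− (Span-null x Ax≃0 F) (Span-null x Ax≃0 G))
  Span-null x Ax≃0 (resp f≗g F)         = null-resp (⟨⟩-congˡ x f≗g) (Span-null x Ax≃0 F)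

  Span-+ : ∀ {f g} → Span A f → Span A g → Span A (λ j → f j ℤ.+ g j)
  Span-+ {f} {g} F G = resp (λ j → eq (f j) (g j)) (sub F (sub zero G))
    where
    eq : ∀ a b → a ℤ.- (0ℤ ℤ.- b) ≡ a ℤ.+ b
    eq = ℤ-Solver.solve-∀

  Span-* : ∀ {f} c → Span A f → Span A (λ j → + c ℤ.* f j)
  Span-* {f} zero    F = resp (λ j → sym (ℤ.*-zeroˡ (f j))) zero
  Span-* {f} (suc c) F = resp (λ j → sym (ℤ.suc-* (+ c) (f j))) (Span-+ F (Span-* c F))

-- Separating forms and the sensing property

-- A certificate that any `ℓ` columns are linearly independent: each column of a small set `S` is
-- singled out within `S` by a form from the row span.
Separates : ℕ → Matrix ℤ n d → Set
Separates {d = d} ℓ A = ∀ (S : Subset d) {j} → ∣ S ∣ ≤ ℓ → j ∈ S →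
  ∃[ f ] (Span A f × f j ≢ 0ℤ × (∀ {i} → i ∈ S → i ≢ j → f i ≡ 0ℤ))

module _ {ℓ} {A : Matrix ℤ n d} (sep : Separates ℓ A) (x : Fin d → ℕ → ℚ)
  (null?  : ∀ j → Dec (Null (x j)))
  (sparse : ∀ (S : Subset d) → (∀ {j} → j ∈ S → ¬ Null (x j)) → ∣ S ∣ ≤ ℓ)
  (Ax≃0   : ∀ i → Null ⟨ A i , x ⟩)
  where

  private
    S : Subset d
    S = Vec.tabulate (λ j → not (does (null? j)))

    ∈S⇒≄0 : ∀ {j} → j ∈ S → ¬ Null (x j)
    ∈S⇒≄0 {j} j∈S with null? j | trans (sym (Vec.lookup∘tabulate _ j)) (Vec.[]=⇒lookup j∈S)
    ... | no xⱼ≄0 | _ = xⱼ≄0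

    ≄0⇒∈S : ∀ {j} → ¬ Null (x j) → j ∈ S
    ≄0⇒∈S {j} xⱼ≄0 = Vec.lookup⇒[]= j S
      (trans (Vec.lookup∘tabulate _ j) (cong not (dec-false (null? j) xⱼ≄0)))

    -- In the null sum of the terms `f i * x i`, those with `i` outside the support are null because
    -- `x i` is, and those inside with `i ≢ j` because `f i` is zero. Only the term at `j` is left,
    -- and its coefficient cancels.
    ∈S⇒≃0 : ∀ {j} → j ∈ S → Null (x j)
    ∈S⇒≃0 {j} j∈S with sep S (sparse S ∈S⇒≄0) j∈S
    ... | f , F , fⱼ≢0 , f≡0 = null-cancel fⱼ≢0 (∑-isolate j others (Span-null x Ax≃0 F))
      where
      others : ∀ i → i ≢ j → Null (λ n → f i ℚ./ 1 ℚ.* x i n)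
      others i i≢j with null? i
      ... | yes xᵢ≃0 = null-*ʳ (f i ℚ./ 1) xᵢ≃0
      ... | no  xᵢ≄0 = null-*ˡ (x i) (f≡0 (≄0⇒∈S xᵢ≄0) i≢j)

  separates⇒null : ∀ j → Null (x j)
  separates⇒null j with null? j
  ... | yes xⱼ≃0 = xⱼ≃0
  ... | no  xⱼ≄0 = ∈S⇒≃0 (≄0⇒∈S xⱼ≄0)

-- The support of x is only available under a double negation, which is harmless
-- since the conclusion is a negation.
separates⇒sensing : ∀ {ℓ} (A : Matrix ℤ n d) → Separates ℓ A → IsSensing ℓ (realMatrix A)
separates⇒sensing A sep x x≄0 sparse Ax≃0 =
  Fin.sequence rawApplicative (λ j → ¬¬-excluded-middle {A = Null (seq (x j))}) λ null? →
    x≄0 λ j → null⇒≃0 {x j} (separates⇒null sep (seq ∘ x) null?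
      (λ S S≄0 → sparse S λ {j} j∈S xⱼ≃0 → S≄0 j∈S (≃0⇒null {x j} xⱼ≃0))
      (λ i → null-resp (seq-foldr (λ j → realMatrix A i j *ᴿ x j)) (≃0⇒null {(realMatrix A *ᵥ x) i} (Ax≃0 i)))
      j)
  where open RawMonad ¬¬-Monad using (rawApplicative)

-- Digits of the Vandermonde matrix

-- ∏ (z − p i) over i ∈ S
vanishing : ∀ {k} → Subset k → (Fin k → ℕ) → ℕ → ℤ
vanishing []            p z = + 1
vanishing (outside ∷ S) p z = vanishing S (p ∘ suc) z
vanishing (inside  ∷ S) p z = (+ z ℤ.- + p zero) ℤ.* vanishing S (p ∘ suc) z

vanishing-∈ : ∀ {k} {S : Subset k} p {i} → i ∈ S → vanishing S p (p i) ≡ 0ℤ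
vanishing-∈ {S = _ ∷ S}       p {zero}  here        =
  cong (ℤ._* vanishing S (p ∘ suc) (p zero)) (ℤ.+-inverseʳ (+ p zero))
vanishing-∈ {S = outside ∷ S} p {suc i} (there i∈S) = vanishing-∈ (p ∘ suc) i∈S
vanishing-∈ {S = inside  ∷ S} p {suc i} (there i∈S) =
  trans (cong ((+ p (suc i) ℤ.- + p zero) ℤ.*_) (vanishing-∈ (p ∘ suc) i∈S))
  (ℤ.*-zeroʳ (+ p (suc i) ℤ.- + p zero))

vanishing-∉ : ∀ {k} (S : Subset k) p {z} → (∀ {i} → i ∈ S → z ≢ p i) → vanishing S p z ≢ 0ℤ
vanishing-∉ []            p z∉ ()
vanishing-∉ (outside ∷ S) p z∉ eq = vanishing-∉ S (p ∘ suc) (z∉ ∘ there) eq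
vanishing-∉ (inside  ∷ S) p {z} z∉ eq with ℤ.i*j≡0⇒i≡0∨j≡0 (+ z ℤ.- + p zero) eq
... | inj₁ z≡p₀ = z∉ here (ℤ.+-injective (ℤ.i-j≡0⇒i≡j (+ z) (+ p zero) z≡p₀))
... | inj₂ rest = vanishing-∉ S (p ∘ suc) (z∉ ∘ there) rest

x∈S-y⇒x≢y : ∀ {k} {S : Subset k} {i j} → i ∈ S - j → i ≢ j
x∈S-y⇒x≢y {S = inside  ∷ _} {j = zero}  ()   refl
x∈S-y⇒x≢y {S = outside ∷ _} {j = zero}  ()   refl
x∈S-y⇒x≢y {S = _ ∷ _} {j = suc _} (there i∈) refl = x∈S-y⇒x≢y i∈ refl

module _ {A : Matrix ℤ n d} (t : Fin d → ℕ) {ℓ}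
  (monomials : ∀ i → i < ℓ → Span A (λ j → + (t j ^ i)))
  where

  -- The monomial factor makes the induction on `S` work: a new factor `t - p zero` turns the form
  -- into the one of degree shift `suc i` minus `p zero` times the one of shift `i`. The bound on
  -- `i + ∣ S ∣` keeps all degrees below `ℓ`.
  Span-vanishing : ∀ {k} (S : Subset k) p i → i + ∣ S ∣ < ℓ →
                   Span A (λ j → + (t j ^ i) ℤ.* vanishing S p (t j))
  Span-vanishing []            p i i<ℓ = resp (λ j → sym (ℤ.*-identityʳ (+ (t j ^ i))))
    (monomials i (subst (_< ℓ) (ℕ.+-identityʳ i) i<ℓ))
  Span-vanishing (outside ∷ S) p i i<ℓ = Span-vanishing S (p ∘ suc) i i<ℓ
  Span-vanishing (inside  ∷ S) p i i<ℓ = resp (λ j → begin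
    + (t j * t j ^ i) ℤ.* V j ℤ.- + p zero ℤ.* (+ (t j ^ i) ℤ.* V j)
      ≡⟨ cong (λ a → a ℤ.* V j ℤ.- + p zero ℤ.* (+ (t j ^ i) ℤ.* V j)) (ℤ.pos-* (t j) (t j ^ i)) ⟩
    + t j ℤ.* + (t j ^ i) ℤ.* V j ℤ.- + p zero ℤ.* (+ (t j ^ i) ℤ.* V j)
      ≡⟨ factor (+ t j) (+ (t j ^ i)) (V j) (+ p zero) ⟩
    + (t j ^ i) ℤ.* ((+ t j ℤ.- + p zero) ℤ.* V j)                          ∎)
    (sub (Span-vanishing S (p ∘ suc) (suc i) 1+i<ℓ)
         (Span-* (p zero) (Span-vanishing S (p ∘ suc) i (ℕ.<-trans (ℕ.n<1+n _) 1+i<ℓ))))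
    where
    open ≡-Reasoning
    V : Fin d → ℤ
    V j = vanishing S (p ∘ suc) (t j)
    1+i<ℓ : suc i + ∣ S ∣ < ℓ
    1+i<ℓ = subst (_< ℓ) (ℕ.+-suc i ∣ S ∣) i<ℓ
    factor : ∀ a b v c → a ℤ.* b ℤ.* v ℤ.- c ℤ.* (b ℤ.* v) ≡ b ℤ.* ((a ℤ.- c) ℤ.* v)
    factor = ℤ-Solver.solve-∀

  -- As in Lagrange interpolation, the separating form is the polynomial with roots at the points of
  -- `S` other than `t j`. Its degree is less than `ℓ` because `j` has been removed.
  monomials⇒separates : (∀ {i j} → t i ≡ t j → i ≡ j) → Separates ℓ A
  monomials⇒separates t-injective S {j} ∣S∣≤ℓ j∈S =
    -- The factor `+ 1` is the monomial `t i ^ 0`.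
    (λ i → + 1 ℤ.* vanishing (S - j) t (t i)) ,
    Span-vanishing (S - j) t 0 (ℕ.<-≤-trans (Subset.x∈p⇒∣p-x∣<∣p∣ j∈S) ∣S∣≤ℓ) ,
    (λ eq → vanishing-∉ (S - j) t (λ i∈ tⱼ≡tᵢ → x∈S-y⇒x≢y i∈ (sym (t-injective tⱼ≡tᵢ)))
      (trans (sym (ℤ.*-identityˡ _)) eq)) ,
    λ i∈S i≢j → trans (ℤ.*-identityˡ _) (vanishing-∈ t (Subset.x∈p∧x≢y⇒x∈p-y i∈S i≢j))

-- Base 3 digits

digit : ℕ → ℕ → ℕ
digit zero    x = x % 3
digit (suc b) x = digit b (x ℕ./ 3)

digit≤2 : ∀ b x → digit b x ≤ 2
digit≤2 zero    x = ℕ.s≤s⁻¹ (m%n<n x 3)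
digit≤2 (suc b) x = digit≤2 b (x ℕ./ 3)

-- Horner's scheme: the lowest digit plus three times the quotient `g j / 3`, which is below `3 ^ B`
-- and whose digits are the remaining ones.
Span-digits : ∀ {A : Matrix ℤ n d} B (g : Fin d → ℕ) → (∀ j → g j < 3 ^ B) →
              (∀ b → b < B → Span A (λ j → + digit b (g j))) → Span A (λ j → + g j)
Span-digits zero    g g<1 digits = resp (λ j → cong +_ (sym (ℕ.n<1⇒n≡0 (g<1 j)))) zero
Span-digits (suc B) g g<  digits = resp (λ j → sym (split (g j)))
  (Span-+ (digits 0 (s≤s z≤n))
    (Span-* 3 (Span-digits B (λ j → g j ℕ./ 3)
      (λ j → m<n*o⇒m/o<n (subst (g j <_) (ℕ.*-comm 3 (3 ^ B)) (g< j)))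
      (λ b b<B → digits (suc b) (s≤s b<B)))))
  where
  open ≡-Reasoning
  split : ∀ x → + x ≡ + (x % 3) ℤ.+ + 3 ℤ.* + (x ℕ./ 3)
  split x = begin
    + x                                        ≡⟨ cong +_ (m≡m%n+[m/n]*n x 3) ⟩
    + (x % 3 + x ℕ./ 3 * 3)             ≡⟨ cong (λ y → + (x % 3 + y)) (ℕ.*-comm (x ℕ./ 3) 3) ⟩
    + (x % 3) ℤ.+ + (3 * (x ℕ./ 3))     ≡⟨ cong (λ y → + (x % 3) ℤ.+ y) (ℤ.pos-* 3 (x ℕ./ 3)) ⟩
    + (x % 3) ℤ.+ + 3 ℤ.* + (x ℕ./ 3)   ∎

-- Row i * B + b, for b < B, holds the b-th digits of the numbers t^i.
digitMatrix : ∀ n m B .{{_ : NonZero B}} → Matrix ℤ n (3 ^ m)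
digitMatrix n m B r t = + digit (toℕ r % B) (toℕ t ^ (toℕ r ℕ./ B))

module _ {n m B : ℕ} .{{_ : NonZero B}} where

  digitMatrix-row : ∀ i b → b < B → (r<n : b + i * B < n) → ∀ t →
                    digitMatrix n m B (fromℕ< r<n) t ≡ + digit b (toℕ t ^ i)
  digitMatrix-row i b b<B r<n t = cong₂ (λ b i → + digit b (toℕ t ^ i))
    (begin
      toℕ (fromℕ< r<n) % B           ≡⟨ cong (_% B) (Fin.toℕ-fromℕ< r<n) ⟩
      (b + i * B) % B                ≡⟨ [m+kn]%n≡m%n b i B ⟩
      b % B                          ≡⟨ m<n⇒m%n≡m b<B ⟩
      b                              ∎)
    (begin
      toℕ (fromℕ< r<n) ℕ./ B             ≡⟨ cong (ℕ._/ B) (Fin.toℕ-fromℕ< r<n) ⟩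
      (b + i * B) ℕ./ B                  ≡⟨ +-distrib-/-∣ʳ b (divides-refl i) ⟩
      b ℕ./ B + i * B ℕ./ B       ≡⟨ cong₂ _+_ (m<n⇒m/n≡0 b<B) (m*n/n≡m i B) ⟩
      i                                         ∎)
    where open ≡-Reasoning

  -- For `i < ℓ` the number `t ^ i` is below `3 ^ (m * ℓ)`, so `B` digits determine it, and the `ℓ`
  -- blocks of `B` rows fit into `n`. Any further rows only enlarge the span.
  digitMatrix-sensing : ∀ {ℓ} .{{_ : NonZero m}} → m * ℓ ≤ B → ℓ * B ≤ n →
                        IsSensing ℓ (realMatrix (digitMatrix n m B))
  digitMatrix-sensing {ℓ} mℓ≤B ℓB≤n = separates⇒sensing (digitMatrix n m B)
    (monomials⇒separates toℕ monomials Fin.toℕ-injective)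
    where
    open ℕ.≤-Reasoning
    monomials : ∀ i → i < ℓ → Span (digitMatrix n m B) (λ t → + (toℕ t ^ i))
    monomials i i<ℓ = Span-digits B (λ t → toℕ t ^ i)
      (λ t → begin-strict
        toℕ t ^ i      ≤⟨ ℕ.^-monoˡ-≤ i (ℕ.<⇒≤ (Fin.toℕ<n t)) ⟩
        (3 ^ m) ^ i    ≡⟨ ℕ.^-*-assoc 3 m i ⟩
        3 ^ (m * i)    <⟨ ℕ.^-monoʳ-< 3 (s≤s (s≤s z≤n)) (ℕ.*-monoʳ-< m i<ℓ) ⟩
        3 ^ (m * ℓ)    ≤⟨ ℕ.^-monoʳ-≤ 3 mℓ≤B ⟩
        3 ^ B          ∎)
      (λ b b<B → resp (digitMatrix-row i b b<B (r<n b b<B)) (row (fromℕ< (r<n b b<B))))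
      where
      r<n : ∀ b → b < B → b + i * B < n
      r<n b b<B = begin-strict
        b + i * B   <⟨ ℕ.+-monoˡ-< (i * B) b<B ⟩
        suc i * B   ≤⟨ ℕ.*-monoˡ-≤ B i<ℓ ⟩
        ℓ * B       ≤⟨ ℓB≤n ⟩
        n           ∎

-- Heights

foldr-⊔-≤ : ∀ {c} (v : Vector ℕ d) → (∀ i → v i ≤ c) → foldr _⊔_ 0 v ≤ c
foldr-⊔-≤ {zero}  v v≤c = z≤n
foldr-⊔-≤ {suc d} v v≤c = ℕ.⊔-lub (v≤c zero) (foldr-⊔-≤ (v ∘ suc) (v≤c ∘ suc))

≤-foldr-⊔ : ∀ (v : Vector ℕ d) i → v i ≤ foldr _⊔_ 0 v
≤-foldr-⊔ v zero    = ℕ.m≤m⊔n _ _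
≤-foldr-⊔ v (suc i) = ℕ.≤-trans (≤-foldr-⊔ (v ∘ suc) i) (ℕ.m≤n⊔m (v zero) _)

height≡ : ∀ {c} (A : Matrix ℤ n d) → (∀ i j → ℤ.∣ A i j ∣ ≤ c) → ∀ i j → ℤ.∣ A i j ∣ ≡ c → height A ≡ c
height≡ A A≤c i j eq = ℕ.≤-antisym
  (foldr-⊔-≤ _ λ i → foldr-⊔-≤ _ (A≤c i))
  (subst (_≤ height A) eq (ℕ.≤-trans (≤-foldr-⊔ (λ j → ℤ.∣ A i j ∣) j) (≤-foldr-⊔ (λ i → foldr _⊔_ 0 (λ j → ℤ.∣ A i j ∣)) i)))

-- The entry 2 is the lowest digit of 2¹.
digitMatrix-height : ∀ {n m B} .{{_ : NonZero B}} .{{_ : NonZero m}} → B < n → height (digitMatrix n m B) ≡ 2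
digitMatrix-height {n} {m@(suc m-1)} {B} B<n = height≡ (digitMatrix n m B) (λ r t → digit≤2 (toℕ r % B) (toℕ t ^ (toℕ r ℕ./ B)))
  (fromℕ< r<n) (fromℕ< 2<3^m)
  (cong ℤ.∣_∣ (trans (digitMatrix-row {n} {m} {B} 1 0 (ℕ.>-nonZero⁻¹ B) r<n (fromℕ< 2<3^m))
    (cong (λ t → + digit 0 (t ^ 1)) (Fin.toℕ-fromℕ< 2<3^m))))
  where
  r<n : 1 * B < n
  r<n = subst (_< n) (sym (ℕ.*-identityˡ B)) B<n
  2<3^m : 2 < 3 ^ m
  2<3^m = ℕ.*-monoʳ-≤ 3 (ℕ.m^n>0 3 m-1)

-- Twice the identity matrix

2I : ∀ n → Matrix ℤ n n
2I n i j with i Fin.≟ j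
... | yes _ = + 2
... | no  _ = 0ℤ

2I-diagonal : ∀ (i : Fin n) → 2I n i i ≡ + 2
2I-diagonal i with i Fin.≟ i
... | yes _  = refl
... | no i≢i = contradiction refl i≢i

2I-off-diagonal : ∀ {i j : Fin n} → i ≢ j → 2I n i j ≡ 0ℤ
2I-off-diagonal {i = i} {j} i≢j with i Fin.≟ j
... | yes i≡j = contradiction i≡j i≢j
... | no  _   = refl

-- Row `j` is zero away from coordinate `j`, so it separates `j` from any set.
2I-sensing : ∀ n ℓ → IsSensing ℓ (realMatrix (2I n))
2I-sensing n ℓ = separates⇒sensing (2I n) λ S {j} _ _ →
  2I n j , row j , (λ eq → contradiction (trans (sym (2I-diagonal j)) eq) λ ()) ,
  λ _ i≢j → 2I-off-diagonal (i≢j ∘ sym)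

2I-height : Fin n → height (2I n) ≡ 2
2I-height {n} i = height≡ (2I n) bound i i (cong ℤ.∣_∣ (2I-diagonal i))
  where
  bound : ∀ i j → ℤ.∣ 2I n i j ∣ ≤ 2
  bound i j with i Fin.≟ j
  ... | yes _ = ℕ.≤-refl
  ... | no  _ = z≤n

^-distribʳ-* : ∀ e a b → (a * b) ^ e ≡ a ^ e * b ^ e
^-distribʳ-* zero    a b = refl
^-distribʳ-* (suc e) a b = trans (cong (a * b *_) (^-distribʳ-* e a b)) (swap a b (a ^ e) (b ^ e))
  where
  swap : ∀ a b u v → a * b * (u * v) ≡ a * u * (b * v)
  swap = ℕ-Solver.solve-∀

-- Bounds on the power

-- Compare `q`-th powers: `powNum-lower` and the hypothesis bound that of `k` by that of
-- `d * suc n`, after cancelling `b ^ p`.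
powSeq-≤ : ∀ a b p q d .{{_ : NonZero b}} .{{_ : NonZero q}} → a ^ p ≤ d ^ q * b ^ p →
           ∀ n → powSeq a b p q n ℚ.≤ + d ℚ./ 1
powSeq-≤ a b p q d a^p≤ n = ℚ.toℚᵘ-cancel-≤ (ℚᵘ.≤-respˡ-≃ (ℚᵘ.≃-sym (ℚ.toℚᵘ-fromℚᵘ (mkℚᵘ (+ k) n)))
  (ℚᵘ.≤-respʳ-≃ (ℚᵘ.≃-sym (ℚ.toℚᵘ-fromℚᵘ (mkℚᵘ (+ d) 0)))
    (ℚᵘ.*≤* (subst₂ ℤ._≤_ (ℤ.pos-* k 1) (ℤ.pos-* d (suc n)) (ℤ.+≤+ (begin
      k * 1       ≡⟨ ℕ.*-identityʳ k ⟩
      k           ≤⟨ k≤dN ⟩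
      d * suc n   ∎))))))
  where
  open ℕ.≤-Reasoning
  k : ℕ
  k = powNum a b p q n
  swap : ∀ x y z → x * y * z ≡ x * z * y
  swap = ℕ-Solver.solve-∀
  k^q≤ : k ^ q * b ^ p ≤ (d * suc n) ^ q * b ^ p
  k^q≤ = begin
    k ^ q * b ^ p                ≤⟨ powNum-lower a b p q n ⟩
    a ^ p * suc n ^ q            ≤⟨ ℕ.*-monoˡ-≤ (suc n ^ q) a^p≤ ⟩
    d ^ q * b ^ p * suc n ^ q    ≡⟨ swap (d ^ q) (b ^ p) (suc n ^ q) ⟩
    d ^ q * suc n ^ q * b ^ p    ≡⟨ cong (_* b ^ p) (^-distribʳ-* q d (suc n)) ⟨
    (d * suc n) ^ q * b ^ p      ∎
  k≤dN : k ≤ d * suc n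
  k≤dN = ℕ.≮⇒≥ λ dN<k → ℕ.<⇒≱ (ℕ.^-monoˡ-< q dN<k)
    (ℕ.*-cancelʳ-≤ (k ^ q) ((d * suc n) ^ q) (b ^ p) {{ℕ.m^n≢0 b p}} k^q≤)

-- The hypothesis is the desired bound raised to the power `k` and cleared of denominators.
-- Unnormalised addition computes the exponent as the fraction of `1 * k + 2` by `1 * k`.
^ᴿ-≤ : ∀ a k d .{{_ : NonZero k}} → a ^ (k + 2) ≤ d ^ k * 2 ^ (k + 2) →
       (+ a / 2) ^ᴿ (1ℚᵘ ℚᵘ.+ + 2 / k) ≤ᴿ fromℕ d
^ᴿ-≤ a k@(suc k-1) d a^≤ ε 0<ε = 0 , λ n _ → ℚ.≤-trans
  (powSeq-≤ a 2 (1 * k + 2) (1 * k) d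
    (subst (λ k → a ^ (k + 2) ≤ d ^ k * 2 ^ (k + 2)) (sym (ℕ.*-identityˡ k)) a^≤) n)
  (ℚ.≤-trans (ℚ.≤-reflexive (sym (ℚ.+-identityʳ (+ d ℚ./ 1)))) (ℚ.+-monoʳ-≤ (+ d ℚ./ 1) (ℚ.<⇒≤ 0<ε)))

-- The sparsity is suc ℓ, so that suc (3 * ℓ) stands for 3 * suc ℓ ∸ 2.
n²≤2^ℓ⇒bound : ∀ n ℓ → 4 ≤ n → n * n ≤ 2 ^ suc ℓ →
               (n + 2) ^ (suc (3 * ℓ) + 2) ≤ n ^ suc (3 * ℓ) * 2 ^ (suc (3 * ℓ) + 2)
n²≤2^ℓ⇒bound n ℓ 4≤n n²≤ = begin
  (n + 2) ^ (suc (3 * ℓ) + 2)          ≡⟨ cong ((n + 2) ^_) 3ℓ+3 ⟩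
  (n + 2) ^ (3 * suc ℓ)                ≡⟨ ℕ.^-*-assoc (n + 2) 3 (suc ℓ) ⟨
  -- Each cube costs a factor 4 where the right-hand side offers 8. The surplus `2 ^ suc ℓ` pays for
  -- the two missing factors `n`.
  ((n + 2) ^ 3) ^ suc ℓ                ≤⟨ ℕ.^-monoˡ-≤ (suc ℓ) cube ⟩
  (4 * n ^ 3) ^ suc ℓ                  ≡⟨ ^-distribʳ-* (suc ℓ) 4 (n ^ 3) ⟩
  4 ^ suc ℓ * (n ^ 3) ^ suc ℓ          ≡⟨ cong (4 ^ suc ℓ *_) (trans (ℕ.^-*-assoc n 3 (suc ℓ)) (cong (n ^_) (sym 3ℓ+3′))) ⟩
  4 ^ suc ℓ * (n * (n * n ^ suc (3 * ℓ)))   ≡⟨ rearrange (4 ^ suc ℓ) n (n ^ suc (3 * ℓ)) ⟩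
  n ^ suc (3 * ℓ) * (n * n * 4 ^ suc ℓ)     ≤⟨ ℕ.*-monoʳ-≤ (n ^ suc (3 * ℓ)) (ℕ.*-monoˡ-≤ (4 ^ suc ℓ) n²≤) ⟩
  n ^ suc (3 * ℓ) * (2 ^ suc ℓ * 4 ^ suc ℓ) ≡⟨ cong (n ^ suc (3 * ℓ) *_) (^-distribʳ-* (suc ℓ) 2 4) ⟨
  n ^ suc (3 * ℓ) * 8 ^ suc ℓ               ≡⟨ cong (n ^ suc (3 * ℓ) *_) (trans (ℕ.^-*-assoc 2 3 (suc ℓ)) (cong (2 ^_) (sym 3ℓ+3))) ⟩
  n ^ suc (3 * ℓ) * 2 ^ (suc (3 * ℓ) + 2)   ∎
  where
  open ℕ.≤-Reasoning
  3ℓ+3 : suc (3 * ℓ) + 2 ≡ 3 * suc ℓ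
  3ℓ+3 = eq ℓ
    where
    eq : ∀ ℓ → suc (3 * ℓ) + 2 ≡ 3 * suc ℓ
    eq = ℕ-Solver.solve-∀
  3ℓ+3′ : 2 + suc (3 * ℓ) ≡ 3 * suc ℓ
  3ℓ+3′ = trans (ℕ.+-comm 2 (suc (3 * ℓ))) 3ℓ+3
  rearrange : ∀ a b c → a * (b * (b * c)) ≡ c * (b * b * a)
  rearrange = ℕ-Solver.solve-∀
  expand : ∀ k → 4 * ((4 + k) * ((4 + k) * ((4 + k) * 1))) ≡
    (4 + k + 2) * ((4 + k + 2) * ((4 + k + 2) * 1)) + (3 * (k * k * k) + 30 * (k * k) + 84 * k + 40)
  expand = ℕ-Solver.solve-∀
  -- With `n` written as `4 + k`, the difference is a polynomial in `k` with positive coefficients.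
  -- At 3 the inequality fails: 125 exceeds 108.
  cube : (n + 2) ^ 3 ≤ 4 * n ^ 3
  cube with k , refl ← ℕ.m≤n⇒∃[o]m+o≡n 4≤n = subst ((4 + k + 2) ^ 3 ≤_) (sym (expand k)) (ℕ.m≤m+n _ _)

-- The base `(n + 2) / 2` is at most `n`, and the exponent `(k + 2) / k` is at most 3.
n³≤d⇒bound : ∀ n d k .{{_ : NonZero k}} → 2 ≤ n → n ^ 3 ≤ d →
             (n + 2) ^ (k + 2) ≤ d ^ k * 2 ^ (k + 2)
n³≤d⇒bound n@(suc _) d k@(suc k-1) 2≤n n³≤d = begin
  (n + 2) ^ (k + 2)            ≤⟨ ℕ.^-monoˡ-≤ (k + 2) (ℕ.+-monoʳ-≤ n 2≤n) ⟩
  (n + n) ^ (k + 2)            ≡⟨ cong (_^ (k + 2)) (double n) ⟩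
  (n * 2) ^ (k + 2)            ≡⟨ ^-distribʳ-* (k + 2) n 2 ⟩
  n ^ (k + 2) * 2 ^ (k + 2)    ≤⟨ ℕ.*-monoˡ-≤ (2 ^ (k + 2)) (ℕ.^-monoʳ-≤ n k+2≤3k) ⟩
  n ^ (3 * k) * 2 ^ (k + 2)    ≡⟨ cong (_* 2 ^ (k + 2)) (ℕ.^-*-assoc n 3 k) ⟨
  (n ^ 3) ^ k * 2 ^ (k + 2)    ≤⟨ ℕ.*-monoˡ-≤ (2 ^ (k + 2)) (ℕ.^-monoˡ-≤ k n³≤d) ⟩
  d ^ k * 2 ^ (k + 2)          ∎
  where
  open ℕ.≤-Reasoning
  double : ∀ n → n + n ≡ n * 2
  double = ℕ-Solver.solve-∀
  k+2≤3k : k + 2 ≤ 3 * k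
  k+2≤3k = ℕ.+-monoʳ-≤ k (ℕ.*-monoʳ-≤ 2 (s≤s (z≤n {k-1})))

-- Choice of m

dyadic : ∀ n .{{_ : NonZero n}} → ∃[ k ] (2 ^ k ≤ n × n < 2 ^ suc k)
dyadic 1 = 0 , ℕ.≤-refl , ℕ.≤-refl
dyadic (suc n@(suc _)) with dyadic n
... | k , 2^k≤n , n<2^k+1 with suc n ℕ.<? 2 ^ suc k
... | yes 1+n<  = k , ℕ.m≤n⇒m≤1+n 2^k≤n , 1+n<
... | no  1+n≮  = suc k , ℕ.≮⇒≥ 1+n≮ ,
  ℕ.≤-<-trans n<2^k+1 (ℕ.^-monoʳ-< 2 ℕ.≤-refl (ℕ.n<1+n (suc k)))

-- In each step the right side doubles, while the cube of a number from 4 on at most doubles. The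
-- start 16 gives the threshold `2 ^ 16`; at 15 the inequality fails.
12[1+k]³<2^k : ∀ {k} → 16 ℕ.≤′ k → 12 * (suc k * suc k * suc k) < 2 ^ k
12[1+k]³<2^k (ℕ.≤′-reflexive refl) = from-yes (12 * (17 * 17 * 17) ℕ.<? 2 ^ 16)
12[1+k]³<2^k {suc k} (ℕ.≤′-step 16≤k) = begin-strict
  12 * (suc s * suc s * suc s)   ≤⟨ ℕ.*-monoʳ-≤ 12 (cube s (ℕ.≤-trans (ℕ.m≤m+n 4 12) (ℕ.m≤n⇒m≤1+n (ℕ.≤′⇒≤ 16≤k)))) ⟩
  12 * (2 * (s * s * s))         ≡⟨ swap (s * s * s) ⟩
  2 * (12 * (s * s * s))         <⟨ ℕ.*-monoʳ-< 2 (12[1+k]³<2^k 16≤k) ⟩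
  2 ^ suc k                      ∎
  where
  open ℕ.≤-Reasoning
  s : ℕ
  s = suc k
  swap : ∀ c → 12 * (2 * c) ≡ 2 * (12 * c)
  swap = ℕ-Solver.solve-∀
  expand : ∀ i → 2 * ((4 + i) * (4 + i) * (4 + i)) ≡
    (5 + i) * (5 + i) * (5 + i) + (i * i * i + 9 * (i * i) + 21 * i + 3)
  expand = ℕ-Solver.solve-∀
  cube : ∀ s → 4 ≤ s → suc s * suc s * suc s ≤ 2 * (s * s * s)
  cube s 4≤s with i , refl ← ℕ.m≤n⇒∃[o]m+o≡n 4≤s =
    subst ((5 + i) * (5 + i) * (5 + i) ≤_) (sym (expand i)) (ℕ.m≤m+n _ _)

parameters : ∀ n ℓ → 2 ^ 16 ≤ n →
             n * n ≤ 2 ^ ℓ ⊎ ∃[ m ] (NonZero m × ℓ * (ℓ * m) < n × n ^ 3 ≤ 3 ^ m)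
parameters n ℓ 2^16≤n with n * n ℕ.≤? 2 ^ ℓ
... | yes n²≤2^ℓ = inj₁ n²≤2^ℓ
... | no  n²≰2^ℓ with dyadic n {{ℕ.>-nonZero (ℕ.<-≤-trans (ℕ.m^n>0 2 16) 2^16≤n)}}
-- Since `n < 2 ^ s`, the exponent `3 * s` already gives `n ^ 3` below a power of 2, hence of 3.
-- With `ℓ ≤ 2 * s` the row count is at most `12 * s ^ 3`.
... | k , 2^k≤n , n<2^s = inj₂ (3 * s , _ , small-ℓ , n³≤)
  where
  open ℕ.≤-Reasoning
  s : ℕ
  s = suc k
  16≤k : 16 ≤ k
  16≤k = ℕ.≮⇒≥ λ k<16 → ℕ.<⇒≱ n<2^s (ℕ.≤-trans (ℕ.^-monoʳ-≤ 2 k<16) 2^16≤n)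
  ℓ≤2s : ℓ ≤ 2 * s
  ℓ≤2s = ℕ.≮⇒≥ λ 2s<ℓ → n²≰2^ℓ (begin
    n * n            ≤⟨ ℕ.*-mono-≤ (ℕ.<⇒≤ n<2^s) (ℕ.<⇒≤ n<2^s) ⟩
    2 ^ s * 2 ^ s    ≡⟨ ℕ.^-distribˡ-+-* 2 s s ⟨
    2 ^ (s + s)      ≡⟨ cong (λ e → 2 ^ (s + e)) (ℕ.+-identityʳ s) ⟨
    2 ^ (2 * s)      ≤⟨ ℕ.^-monoʳ-≤ 2 (ℕ.<⇒≤ 2s<ℓ) ⟩
    2 ^ ℓ            ∎)
  collect : ∀ s → 2 * s * (2 * s * (3 * s)) ≡ 12 * (s * s * s)
  collect = ℕ-Solver.solve-∀
  small-ℓ : ℓ * (ℓ * (3 * s)) < n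
  small-ℓ = begin-strict
    ℓ * (ℓ * (3 * s))            ≤⟨ ℕ.*-mono-≤ ℓ≤2s (ℕ.*-monoˡ-≤ (3 * s) ℓ≤2s) ⟩
    2 * s * (2 * s * (3 * s))    ≡⟨ collect s ⟩
    12 * (s * s * s)             <⟨ 12[1+k]³<2^k (ℕ.≤⇒≤′ 16≤k) ⟩
    2 ^ k                        ≤⟨ 2^k≤n ⟩
    n                            ∎
  n³≤ : n ^ 3 ≤ 3 ^ (3 * s)
  n³≤ = begin
    n ^ 3            ≤⟨ ℕ.^-monoˡ-≤ 3 (ℕ.<⇒≤ n<2^s) ⟩
    (2 ^ s) ^ 3      ≡⟨ ℕ.^-*-assoc 2 s 3 ⟩
    2 ^ (s * 3)      ≡⟨ cong (2 ^_) (ℕ.*-comm s 3) ⟩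
    2 ^ (3 * s)      ≤⟨ ℕ.^-monoˡ-≤ (3 * s) (ℕ.n≤1+n 2) ⟩
    3 ^ (3 * s)      ∎

-- Combining the two constructions

theorem1p1 : Σ[ n₀ ∈ ℕ ] ∀ (n : ℕ) → n ≥ n₀ →
    ∀ (ℓ : ℕ) .{{_ : NonZero ℓ}} → ℓ ≤ n ∸ 1 →
    Σ[ d ∈ ℕ ] Σ[ A ∈ Matrix ℤ n d ]
    ( d ≥ 1
    × IsSensing ℓ (realMatrix A)
    × height A ≡ 2
    × (+ (n + 2) / 2) ^ᴿ (1ℚᵘ ℚᵘ.+ + 2 / (3 * ℓ ∸ 2)) ≤ᴿ fromℕ d )
theorem1p1 = 2 ^ 16 , λ n 2^16≤n ℓ _ →
  construct n ℓ (ℕ.≤-trans (ℕ.^-monoʳ-≤ 2 {2} {16} (s≤s (s≤s z≤n))) 2^16≤n) (parameters n ℓ 2^16≤n)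
  where
  construct : ∀ n ℓ .{{_ : NonZero ℓ}} → 4 ≤ n →
    n * n ≤ 2 ^ ℓ ⊎ ∃[ m ] (NonZero m × ℓ * (ℓ * m) < n × n ^ 3 ≤ 3 ^ m) →
    Σ[ d ∈ ℕ ] Σ[ A ∈ Matrix ℤ n d ]
    ( d ≥ 1
    × IsSensing ℓ (realMatrix A)
    × height A ≡ 2
    × (+ (n + 2) / 2) ^ᴿ (1ℚᵘ ℚᵘ.+ + 2 / (3 * ℓ ∸ 2)) ≤ᴿ fromℕ d )
  construct n ℓ@(suc ℓ-1) 4≤n (inj₁ n²≤2^ℓ) =
    n , 2I n , 1≤n , 2I-sensing n ℓ , 2I-height (fromℕ< 1≤n) ,
    ^ᴿ-≤ (n + 2) (3 * ℓ ∸ 2) n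
      -- For `ℓ = suc ℓ-1`, truncated subtraction turns `3 * ℓ ∸ 2` into `suc (3 * ℓ-1)`.
      (subst (λ k → (n + 2) ^ (k + 2) ≤ n ^ k * 2 ^ (k + 2)) (sym (cong (_∸ 2) (ℕ.*-suc 3 ℓ-1)))
        (n²≤2^ℓ⇒bound n ℓ-1 4≤n n²≤2^ℓ))
    where
    1≤n : 1 ≤ n
    1≤n = ℕ.≤-trans (s≤s z≤n) 4≤n
  construct n ℓ {{ℓ≢0}} 4≤n (inj₂ (m , m≢0 , ℓB<n , n³≤3^m)) =
    3 ^ m , digitMatrix n m B {{B≢0}} , ℕ.m^n>0 3 m ,
    digitMatrix-sensing {n} {m} {B} {{B≢0}} {ℓ} {{m≢0}}
      (ℕ.≤-reflexive (ℕ.*-comm m ℓ)) (ℕ.<⇒≤ ℓB<n) ,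
    -- The entry 2 sits in row number `B`, counted from zero, so `B < n` must be strict.
    digitMatrix-height {n} {m} {B} {{B≢0}} {{m≢0}} (ℕ.≤-<-trans (ℕ.m≤n*m B ℓ {{ℓ≢0}}) ℓB<n) ,
    ^ᴿ-≤ (n + 2) (3 * ℓ ∸ 2) (3 ^ m)
      (n³≤d⇒bound n (3 ^ m) (3 * ℓ ∸ 2) (ℕ.≤-trans (s≤s (s≤s z≤n)) 4≤n) n³≤3^m)
    where
    B : ℕ
    B = ℓ * m
    B≢0 : NonZero B
    B≢0 = ℕ.m*n≢0 ℓ m {{ℓ≢0}} {{m≢0}}
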